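{- Let $q$ be an odd prime power and let $\gamma\in\mathbb{F}_{q^2}$. The polynomial $f(x)=x+\gamma\,\mathrm{Tr}\left(x^{q+3}-x^{2q+2}\right)$ over $\mathbb{F}_{q^2}$ is a permutation polynomial if and only if $\gamma=0$.
   Context: $\mathrm{Tr}:\mathbb{F}_{q^2}\to\mathbb{F}_q$ is the trace map $\mathrm{Tr}(x)=x+x^q$. A polynomial $f$ over $\mathbb{F}_{q^2}$ is a permutation polynomial if the map $x\mapsto f(x)$ is a bijection of $\mathbb{F}_{q^2}$ onto itself. -}

module Defs where

open import Algebra.Apartness.Bundles using (HeytingField; HeytingCommutativeRing)
open import Algebra.Bundles using (CommutativeRing)
import Algebra.Properties.Semiring.Exp as Exp
open import Data.Fin.Base using (Fin)
open import Data.Nat.Base as ℕ using (ℕ; _≤_)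
open import Data.Nat.Divisibility using (_∣_)
open import Data.Nat.Primality using (Prime)
open import Data.Product.Base using (_×_; ∃₂)
open import Function.Bundles using (Bijection)
open import Function.Definitions using (Bijective)
open import Level using (Level; _⊔_)
open import Relation.Binary.Bundles using (Setoid)
open import Relation.Binary.PropositionalEquality.Core using (_≡_)
import Relation.Binary.PropositionalEquality.Properties as ≡
open import Relation.Nullary.Negation.Core using (¬_)

IsPrimePower : ℕ → Set
IsPrimePower q = ∃₂ λ p k → Prime p × 1 ≤ k × q ≡ p ℕ.^ k

IsOddPrimePower : ℕ → Set
IsOddPrimePower q = IsPrimePower q × ¬ (2 ∣ q)

HasCardinality : ∀ {c ℓ} → Setoid c ℓ → ℕ → Set (c ⊔ ℓ)
HasCardinality S n = Bijection S (≡.setoid (Fin n))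

-- `HeytingField` does not itself require 0# and 1# to be apart, but a ring with
-- at least two elements is nontrivial.  On a finite carrier _≈_ is decidable and
-- _#_ is logically equivalent to its negation, so that such an F is a field in
-- the usual sense.
module _ {c ℓ₁ ℓ₂ : Level} (F : HeytingField c ℓ₁ ℓ₂) where

  private
    ring : CommutativeRing c ℓ₁
    ring = HeytingCommutativeRing.commutativeRing
             (HeytingField.heytingCommutativeRing F)

  open CommutativeRing ring
    using (Carrier; _≈_; _+_; _*_; _-_; setoid; semiring)
  open Exp semiring using (_^_)

  IsFieldOfOrder : ℕ → Set (c ⊔ ℓ₁)
  IsFieldOfOrder = HasCardinality setoid

  -- When F has order q², the values of Tr q lie in the subfield of order q,
  -- which is { y | y ^ q ≈ y }; here they are regarded as elements of F.
  Tr : ℕ → Carrier → Carrier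
  Tr q x = x + x ^ q

  -- A polynomial is represented by the map x ↦ f(x) that it induces on F.
  IsPermutationPolynomial : (Carrier → Carrier) → Set (c ⊔ ℓ₁)
  IsPermutationPolynomial f = Bijective _≈_ _≈_ f

  polyF : ℕ → Carrier → Carrier → Carrier
  polyF q γ x = x + γ * Tr q (x ^ (q ℕ.+ 3) - x ^ (2 ℕ.* q ℕ.+ 2))

{-# OPTIONS --safe #-}

-- Write x̄ = x^q, and call x real if x̄ = x.  Then f(x) = x + γ x x̄ (x - x̄)², and if γ ≠ 0 two distinct points with
-- the same value can be exhibited.
-- * If γ̄ = γ: the points δ and δ - s, where δ ≠ 0, δ̄ = -δ and s = 1 / (4 γ δ²).
-- * If γ̄ ≠ ±γ: the points c + γ and c - γ, where c = -1 / ((γ - γ̄)² (γ + γ̄)).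
-- * If γ̄ = -γ: points c + a γ and c + b γ with real a ≠ b and c, subject to 1 + 4 γ² (a + b) (c² - γ² (a² + b²)) = 0.
--   Since γ² is a sum of two real squares, the last form is isotropic, which gives a solution by a linear equation.
-- That δ exists follows from the root bound for X^(m+1) - X, m = (q² - 1) / 2.  That real elements are sums of two real
-- squares follows from a real square root of -1 when q ≡ 1 mod 4, and from each real element being a square up to
-- sign when q ≡ 3 mod 4.
module Submission where

open import Defs
open import Algebra.Apartness.Bundles using (HeytingField; HeytingCommutativeRing)
open import Algebra.Bundles using (CommutativeMonoid; CommutativeRing; CommutativeSemiring)
open import Data.Fin.Base using (Fin; zero; suc)
open import Data.Integer.Base using (+_)
open import Data.Nat.Base as ℕ using (ℕ; zero; suc; _<_; _∸_; _^_; s≤s)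
open import Data.Nat.DivMod using (_divMod_; result)
open import Data.Nat.Divisibility using (_∣_; _∤_; divides)
open import Data.Nat.Primality using (Prime)
import Data.Nat.Properties as ℕ
open import Data.Product.Base using (∃; ∃₂; _,_; proj₁; proj₂)
open import Data.Sum.Base using (_⊎_; inj₁; inj₂; [_,_]′)
open import Function.Base using (id; _∘_)
open import Function.Definitions using (Injective)
open import Function.Bundles using (_⇔_; mk⇔; Bijection; Surjection)
open import Relation.Binary.Bundles using (Setoid)
open import Relation.Binary.PropositionalEquality.Core as ≡ using (_≡_; _≢_)
open import Relation.Nullary.Decidable using (Dec; yes; no; decidable-stable)
open import Relation.Nullary.Negation.Core using (¬_; contradiction)

-- Ring solver with integer coefficients over a commutative ring.

module IntegerSolver {c ℓ} (R : CommutativeRing c ℓ) where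

  open import Data.Integer.Base as ℤ using (ℤ; -[1+_]; _⊖_)
  open import Algebra.Bundles using (RawRing)
  open import Algebra.Solver.Ring.AlmostCommutativeRing
    using (_-Raw-AlmostCommutative⟶_; fromCommutativeRing)
  import Data.Integer.Properties as ℤ
  open import Data.Maybe.Base using (Maybe; map)
  open import Relation.Nullary.Decidable using (dec⇒maybe)

  open CommutativeRing R hiding (zero)
  open import Algebra.Properties.Ring ring
  open import Algebra.Properties.Semiring.Mult.TCOptimised semiring
  open import Relation.Binary.Reasoning.Setoid setoid

  private

    -- The optimised multiple reduces `1 × 1#` to `1#`, so that `con (+ 1)` denotes `1#` by
    -- definition.
    ⟦_⟧ : ℤ → Carrier
    ⟦ + n ⟧      = n × 1#
    ⟦ -[1+ n ] ⟧ = - (suc n × 1#)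

    ⊖-homo : ∀ m n → ⟦ m ⊖ n ⟧ ≈ m × 1# - n × 1#
    ⊖-homo zero    zero    = sym (-‿inverseʳ 0#)
    ⊖-homo zero    (suc n) = sym (+-identityˡ _)
    ⊖-homo (suc m) zero    = sym (trans (+-congˡ -0#≈0#) (+-identityʳ _))
    ⊖-homo (suc m) (suc n) = begin
      ⟦ suc m ⊖ suc n ⟧                  ≡⟨ ≡.cong ⟦_⟧ (ℤ.[1+m]⊖[1+n]≡m⊖n m n) ⟩
      ⟦ m ⊖ n ⟧                          ≈⟨ ⊖-homo m n ⟩
      m × 1# - n × 1#                    ≈⟨ +-congʳ (trans (+-congʳ (-‿inverseˡ 1#)) (+-identityˡ _)) ⟨
      (- 1# + 1#) + m × 1# - n × 1#      ≈⟨ +-congʳ (+-assoc (- 1#) 1# _) ⟩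
      - 1# + (1# + m × 1#) - n × 1#      ≈⟨ +-congʳ (+-comm (- 1#) _) ⟩
      (1# + m × 1#) - 1# - n × 1#        ≈⟨ +-assoc _ (- 1#) _ ⟩
      (1# + m × 1#) + (- 1# - n × 1#)    ≈⟨ +-congˡ (-‿+-comm 1# (n × 1#)) ⟩
      (1# + m × 1#) - (1# + n × 1#)      ≈⟨ +-cong (1+× m 1#) (-‿cong (1+× n 1#)) ⟨
      suc m × 1# - suc n × 1#            ∎

    +-homo : ∀ i j → ⟦ i ℤ.+ j ⟧ ≈ ⟦ i ⟧ + ⟦ j ⟧
    +-homo (+ m)    (+ n)    = ×-homo-+ 1# m n
    +-homo (+ m)    -[1+ n ] = ⊖-homo m (suc n)
    +-homo -[1+ m ] (+ n)    = trans (⊖-homo n (suc m)) (+-comm _ _)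
    +-homo -[1+ m ] -[1+ n ] = begin
      - (suc (suc (m ℕ.+ n)) × 1#)       ≡⟨ ≡.cong (λ k → - (k × 1#)) (ℕ.+-suc (suc m) n) ⟨
      - ((suc m ℕ.+ suc n) × 1#)         ≈⟨ -‿cong (×-homo-+ 1# (suc m) (suc n)) ⟩
      - (suc m × 1# + suc n × 1#)        ≈⟨ -‿+-comm _ _ ⟨
      - (suc m × 1#) - suc n × 1#        ∎

    -‿homo : ∀ i → ⟦ ℤ.- i ⟧ ≈ - ⟦ i ⟧
    -‿homo (+ zero)  = sym -0#≈0#
    -‿homo (+ suc n) = refl
    -‿homo -[1+ n ]  = sym (-‿involutive _)

    +*-homo : ∀ m j → ⟦ + m ℤ.* j ⟧ ≈ m × 1# * ⟦ j ⟧
    +*-homo m (+ n) = begin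
      ⟦ + m ℤ.* + n ⟧                    ≡⟨ ≡.cong ⟦_⟧ (ℤ.pos-* m n) ⟨
      (m ℕ.* n) × 1#                     ≈⟨ ×1-homo-* m n ⟩
      m × 1# * n × 1#                    ∎
    +*-homo m -[1+ n ] = begin
      ⟦ + m ℤ.* -[1+ n ] ⟧               ≡⟨ ≡.cong ⟦_⟧ (ℤ.neg-distribʳ-* (+ m) (+ suc n)) ⟨
      ⟦ ℤ.- (+ m ℤ.* + suc n) ⟧          ≈⟨ -‿homo (+ m ℤ.* + suc n) ⟩
      - ⟦ + m ℤ.* + suc n ⟧              ≈⟨ -‿cong (+*-homo m (+ suc n)) ⟩
      - (m × 1# * suc n × 1#)            ≈⟨ -‿distribʳ-* _ _ ⟩
      m × 1# * - (suc n × 1#)            ∎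

    *-homo : ∀ i j → ⟦ i ℤ.* j ⟧ ≈ ⟦ i ⟧ * ⟦ j ⟧
    *-homo (+ m)    j = +*-homo m j
    *-homo -[1+ m ] j = begin
      ⟦ -[1+ m ] ℤ.* j ⟧                 ≡⟨ ≡.cong ⟦_⟧ (ℤ.neg-distribˡ-* (+ suc m) j) ⟨
      ⟦ ℤ.- (+ suc m ℤ.* j) ⟧            ≈⟨ -‿homo (+ suc m ℤ.* j) ⟩
      - ⟦ + suc m ℤ.* j ⟧                ≈⟨ -‿cong (+*-homo (suc m) j) ⟩
      - (suc m × 1# * ⟦ j ⟧)             ≈⟨ -‿distribˡ-* _ _ ⟩
      - (suc m × 1#) * ⟦ j ⟧             ∎

    ℤ-rawRing : RawRing _ _
    ℤ-rawRing = record
      { _≈_ = _≡_ ; _+_ = ℤ._+_ ; _*_ = ℤ._*_ ; -_ = ℤ.-_ ; 0# = ℤ.0ℤ ; 1# = ℤ.1ℤ }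

    homomorphism : ℤ-rawRing -Raw-AlmostCommutative⟶ fromCommutativeRing R
    homomorphism = record
      { ⟦_⟧    = ⟦_⟧
      ; +-homo = +-homo
      ; *-homo = *-homo
      ; -‿homo = -‿homo
      ; 0-homo = refl
      ; 1-homo = refl
      }

    -- Coefficients are compared as integers, since equality in R need not be decidable.
    ⟦_⟧-≈? : ∀ i j → Maybe (⟦ i ⟧ ≈ ⟦ j ⟧)
    ⟦_⟧-≈? i j = map (λ i≡j → reflexive (≡.cong ⟦_⟧ i≡j)) (dec⇒maybe (i ℤ.≟ j))

  open import Algebra.Solver.Ring ℤ-rawRing (fromCommutativeRing R) homomorphism ⟦_⟧-≈? public
    using (Polynomial; solve; _:=_; _:+_; _:*_; _:-_; :-_; con)

-- Root bound for monic polynomials.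

-- Monic polynomials in Horner form: the vector c₀ ∷ … ∷ cₘ₋₁ stands for c₀ + c₁ x + … + cₘ₋₁ xᵐ⁻¹ + xᵐ.
module MonicPolynomial {c ℓ} (R : CommutativeRing c ℓ) where

  open import Data.Vec.Base using (Vec; []; _∷_; replicate)

  open CommutativeRing R hiding (zero)
  open IntegerSolver R
  open import Algebra.Properties.Ring ring
  open import Algebra.Properties.Semiring.Exp semiring using () renaming (_^_ to _^ᴿ_)
  open import Relation.Binary.Reasoning.Setoid setoid

  eval : ∀ {m} → Vec Carrier m → Carrier → Carrier
  eval []       x = 1#
  eval (c ∷ cs) x = c + x * eval cs x

  -- Synthetic division by x - a: the partial Horner values at a are the coefficients of the
  -- quotient, which is again monic.
  quotient : ∀ {m} → Carrier → Vec Carrier (suc m) → Vec Carrier m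
  quotient a (c ∷ [])          = []
  quotient a (c ∷ cs@(_ ∷ _)) = eval cs a ∷ quotient a cs

  eval-quotient : ∀ {m} a (cs : Vec Carrier (suc m)) x →
                  eval cs x ≈ eval cs a + (x - a) * eval (quotient a cs) x
  eval-quotient a (c ∷ []) x =
    solve 3 (λ a c x → c :+ x :* con (+ 1) := c :+ a :* con (+ 1) :+ (x :- a) :* con (+ 1)) refl a c x
  eval-quotient a (c ∷ cs@(_ ∷ _)) x = begin
    c + x * eval cs x
      ≈⟨ +-congˡ (*-congˡ (eval-quotient a cs x)) ⟩
    c + x * (eval cs a + (x - a) * eval (quotient a cs) x)
      ≈⟨ solve 5 (λ a c x e d → c :+ x :* (e :+ (x :- a) :* d) := c :+ a :* e :+ (x :- a) :* (e :+ x :* d))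
           refl a c x (eval cs a) (eval (quotient a cs) x) ⟩
    c + a * eval cs a + (x - a) * (eval cs a + x * eval (quotient a cs) x) ∎

  eval-replicate-0# : ∀ m x → eval (replicate m 0#) x ≈ x ^ᴿ m
  eval-replicate-0# zero    x = refl
  eval-replicate-0# (suc m) x = trans (+-identityˡ _) (*-congˡ (eval-replicate-0# m x))

  module _ (1≉0 : ¬ 1# ≈ 0#) (integral : ∀ {x y} → x * y ≈ 0# → x ≈ 0# ⊎ y ≈ 0#) where

    -- Induction on the degree: divide by x - a for the first root a. As the roots are distinct,
    -- integrality makes every other one a root of the quotient.
    root-bound : ∀ {m} (cs : Vec Carrier m) (r : Fin (suc m) → Carrier) →
                 Injective _≡_ _≈_ r → ¬ (∀ i → eval cs (r i) ≈ 0#)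
    root-bound []          r r-inj roots = 1≉0 (roots zero)
    root-bound cs@(_ ∷ _) r r-inj roots =
      root-bound (quotient a cs) (λ i → r (suc i)) (λ eq → suc-injective (r-inj eq)) roots′
      where
      open import Data.Fin.Properties using (suc-injective)
      a = r zero
      roots′ : ∀ i → eval (quotient a cs) (r (suc i)) ≈ 0#
      roots′ i with integral (begin
        (r (suc i) - a) * eval (quotient a cs) (r (suc i))              ≈⟨ +-identityˡ _ ⟨
        0# + (r (suc i) - a) * eval (quotient a cs) (r (suc i))         ≈⟨ +-congʳ (roots zero) ⟨
        eval cs a + (r (suc i) - a) * eval (quotient a cs) (r (suc i))  ≈⟨ eval-quotient a cs (r (suc i)) ⟨
        eval cs (r (suc i))                                             ≈⟨ roots (suc i) ⟩
        0#                                                              ∎)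
      ... | inj₂ eq = eq
      ... | inj₁ eq = contradiction (r-inj (x∙y⁻¹≈ε⇒x≈y _ _ eq)) λ ()

-- Sums over a finite setoid.

module FiniteSum {a b ℓ₁ ℓ₂} {S : Setoid a ℓ₁} {n} (enum : HasCardinality S n)
                 (M : CommutativeMonoid b ℓ₂) where

  open import Data.Fin.Permutation using (Permutation′; permutation)

  open Setoid S using (Carrier) renaming (_≈_ to _≈ˢ_)
  private
    module S = Setoid S
    module M = CommutativeMonoid M
  open Bijection enum using (to; to⁻; injective)
  open import Algebra.Properties.CommutativeMonoid.Sum M

  to-to⁻ : ∀ i → to (to⁻ i) ≡ i
  to-to⁻ = Surjection.to∘to⁻ (Bijection.surjection enum)

  to⁻-to : ∀ x → to⁻ (to x) ≈ˢ x
  to⁻-to x = injective (to-to⁻ (to x))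

  total : (Carrier → M.Carrier) → M.Carrier
  total h = ∑[ i < n ] h (to⁻ i)

  -- The mutually inverse maps s and t induce a permutation of the indices. Congruence of h is used
  -- because `to⁻ ∘ to` is the identity only up to the setoid equality.
  total-reindex : ∀ {h} → (∀ {x y} → x ≈ˢ y → h x M.≈ h y) →
                  ∀ s t → (∀ {x y} → x ≈ˢ y → s x ≈ˢ s y) → (∀ {x y} → x ≈ˢ y → t x ≈ˢ t y) →
                  (∀ x → s (t x) ≈ˢ x) → (∀ x → t (s x) ≈ˢ x) →
                  total h M.≈ total (h ∘ s)
  total-reindex {h} h-cong s t s-cong t-cong s-t t-s =
    M.trans (sum-permute (h ∘ to⁻) π) (sum-cong-≋ λ i → h-cong (to⁻-to (s (to⁻ i))))
    where
    inv : ∀ (s t : Carrier → Carrier) → (∀ {x y} → x ≈ˢ y → s x ≈ˢ s y) → (∀ x → s (t x) ≈ˢ x) →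
          ∀ i → to (s (to⁻ (to (t (to⁻ i))))) ≡ i
    inv s t s-cong s-t i = ≡.trans
      (Bijection.cong enum (S.trans (s-cong (to⁻-to _)) (s-t _))) (to-to⁻ i)
    π : Permutation′ n
    π = permutation (to ∘ s ∘ to⁻) (to ∘ t ∘ to⁻) (inv s t s-cong s-t) (inv t s t-cong t-s)

-- Additivity of the p-th power map in characteristic p.

module Frobenius {c ℓ} (S : CommutativeSemiring c ℓ) where

  open import Data.Fin.Base using (toℕ; fromℕ; inject₁)
  open import Data.Fin.Properties using (toℕ<n; toℕ-fromℕ; toℕ-inject₁)
  open import Data.Nat.Base using (_!)
  open import Data.Nat.Combinatorics using (_C_; nCk≡n!/k![n-k]!; k![n∸k]!∣n!; nCn≡1)
  open import Data.Nat.Divisibility using (>⇒∤; m∣m*n)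
  open import Data.Nat.DivMod using (m/n*n≡m)
  open import Data.Nat.Primality using (euclidsLemma; prime⇒nonTrivial)

  prime∤! : ∀ {p} → Prime p → ∀ {k} → k < p → p ∤ k !
  prime∤! {p} pr {zero}  _   p∣1 = >⇒∤ (ℕ.nonTrivial⇒n>1 p ⦃ prime⇒nonTrivial pr ⦄) p∣1
  prime∤! pr {suc k} k<p p∣k! with euclidsLemma (suc k) (k !) pr p∣k!
  ... | inj₁ p∣1+k = >⇒∤ k<p p∣1+k
  ... | inj₂ p∣k!  = prime∤! pr (ℕ.<-trans (ℕ.n<1+n k) k<p) p∣k!

  -- The prime p divides p!, the product of the binomial coefficient and two factorials, but divides
  -- neither factorial.
  prime∣C : ∀ {p} → Prime p → ∀ {k} → suc k < p → p ∣ p C suc k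
  prime∣C {p@(suc p-1)} pr {k} k<p with euclidsLemma (p C suc k) (suc k ! ℕ.* (p ∸ suc k) !) pr p∣C*d
    where
    instance _ = ℕ.m*n≢0 (suc k !) ((p ∸ suc k) !) ⦃ suc k ℕ.!≢0 ⦄ ⦃ (p ∸ suc k) ℕ.!≢0 ⦄
    C*d≡p! : (p C suc k) ℕ.* (suc k ! ℕ.* (p ∸ suc k) !) ≡ p !
    C*d≡p! = ≡.trans (≡.cong (ℕ._* (suc k ! ℕ.* (p ∸ suc k) !)) (nCk≡n!/k![n-k]! (ℕ.<⇒≤ k<p)))
      (m/n*n≡m (k![n∸k]!∣n! (ℕ.<⇒≤ k<p)))
    p∣C*d : p ∣ (p C suc k) ℕ.* (suc k ! ℕ.* (p ∸ suc k) !)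
    p∣C*d = ≡.subst (p ∣_) (≡.sym C*d≡p!) (m∣m*n (p-1 !))
  ... | inj₁ p∣C = p∣C
  ... | inj₂ p∣d with euclidsLemma (suc k !) ((p ∸ suc k) !) pr p∣d
  ... | inj₁ p∣k!     = contradiction p∣k! (prime∤! pr k<p)
  ... | inj₂ p∣[p∸k]! = contradiction p∣[p∸k]! (prime∤! pr (s≤s (ℕ.m∸n≤m p-1 k)))

  open CommutativeSemiring S hiding (zero)
  open import Algebra.Properties.CommutativeMonoid.Sum +-commutativeMonoid
    using (sum; sum-cong-≋; sum-replicate-zero; sum-init-last)
  open import Algebra.Properties.CommutativeSemiring.Binomial S using (binomialTerm; theorem)
  open import Algebra.Properties.CommutativeSemiring.Exp S using (^-congˡ; ^-assocʳ) renaming (_^_ to _^ᴿ_)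
  open import Algebra.Properties.Semiring.Mult semiring using (_×_; ×-congˡ; ×-assocˡ; ×-assoc-*; ×-congʳ)
  open import Data.Vec.Functional using (init; tail)
  open import Relation.Binary.Reasoning.Setoid setoid

  module _ {p} (pr : Prime p) (p×1≈0 : p × 1# ≈ 0#) where

    ∣⇒×≈0 : ∀ {n} → p ∣ n → ∀ x → n × x ≈ 0#
    ∣⇒×≈0 {n} (divides m n≡m*p) x = begin
      n × x               ≈⟨ ×-congˡ (≡.trans n≡m*p (ℕ.*-comm m p)) ⟩
      (p ℕ.* m) × x       ≈⟨ ×-assocˡ x p m ⟨
      p × (m × x)         ≈⟨ ×-congʳ p (*-identityˡ (m × x)) ⟨
      p × (1# * (m × x))  ≈⟨ ×-assoc-* p 1# (m × x) ⟨
      (p × 1#) * (m × x)  ≈⟨ *-congʳ p×1≈0 ⟩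
      0# * (m × x)        ≈⟨ zeroˡ _ ⟩
      0#                  ∎

    -- In the binomial expansion all terms but the first and the last have coefficients divisible by
    -- p.
    ^p-homo-+ : ∀ x y → (x + y) ^ᴿ p ≈ x ^ᴿ p + y ^ᴿ p
    ^p-homo-+ x y = go p ≡.refl
      where
      -- The copy n of p can be matched as a successor, which exposes the first and last terms of
      -- the expansion.
      go : ∀ n → n ≡ p → (x + y) ^ᴿ n ≈ x ^ᴿ n + y ^ᴿ n
      go zero    ≡.refl = contradiction pr λ ()
      go (suc m) ≡.refl = begin
        (x + y) ^ᴿ suc m
          ≈⟨ theorem (suc m) x y ⟩
        t zero + sum (tail t)
          ≈⟨ +-cong (trans (+-identityʳ _) (*-identityˡ _)) (sum-init-last (tail t)) ⟩
        y ^ᴿ suc m + (sum (init (tail t)) + t (suc (fromℕ m)))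
          ≈⟨ +-congˡ (+-cong (trans (sum-cong-≋ middle) (sum-replicate-zero m)) lastTerm) ⟩
        y ^ᴿ suc m + (0# + x ^ᴿ suc m)
          ≈⟨ trans (+-comm _ _) (+-congʳ (+-identityˡ _)) ⟩
        x ^ᴿ suc m + y ^ᴿ suc m ∎
        where
        t : Fin (suc (suc m)) → Carrier
        t = binomialTerm x y (suc m)
        middle : ∀ i → t (suc (inject₁ i)) ≈ 0#
        middle i rewrite toℕ-inject₁ i = ∣⇒×≈0 (prime∣C pr (s≤s (toℕ<n i))) _
        lastTerm : t (suc (fromℕ m)) ≈ x ^ᴿ suc m
        lastTerm rewrite toℕ-fromℕ m | nCn≡1 (suc m) | ℕ.n∸n≡0 m =
          trans (+-identityʳ _) (*-identityʳ _)

    ^p^k-homo-+ : ∀ k x y → (x + y) ^ᴿ (p ^ k) ≈ x ^ᴿ (p ^ k) + y ^ᴿ (p ^ k)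
    ^p^k-homo-+ zero    x y = trans (*-identityʳ _) (+-cong (sym (*-identityʳ x)) (sym (*-identityʳ y)))
    ^p^k-homo-+ (suc k) x y = begin
      (x + y) ^ᴿ (p ℕ.* p ^ k)                      ≈⟨ ^-assocʳ (x + y) p (p ^ k) ⟨
      ((x + y) ^ᴿ p) ^ᴿ (p ^ k)                     ≈⟨ ^-congˡ (p ^ k) (^p-homo-+ x y) ⟩
      (x ^ᴿ p + y ^ᴿ p) ^ᴿ (p ^ k)                  ≈⟨ ^p^k-homo-+ k (x ^ᴿ p) (y ^ᴿ p) ⟩
      (x ^ᴿ p) ^ᴿ (p ^ k) + (y ^ᴿ p) ^ᴿ (p ^ k)     ≈⟨ +-cong (^-assocʳ x p (p ^ k)) (^-assocʳ y p (p ^ k)) ⟩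
      x ^ᴿ (p ℕ.* p ^ k) + y ^ᴿ (p ℕ.* p ^ k)       ∎

-- Finite fields: inverses, the additive order of 1, Fermat's theorem, non-roots.

module FiniteField {c ℓ₁ ℓ₂} (F : HeytingField c ℓ₁ ℓ₂) {n} (enum : IsFieldOfOrder F n) where

  open import Data.Fin.Base using (inject≤)
  open import Data.Fin.Properties as Fin using (any?; punchInᵢ≢i; inject≤-injective)
  open import Data.Vec.Base using (_∷_; replicate)
  open import Data.Vec.Functional using (removeAt)
  open import Relation.Binary.Definitions using (Decidable)
  open import Relation.Nullary.Decidable using (map′; ¬?)

  commutativeRing : CommutativeRing c ℓ₁
  commutativeRing = HeytingCommutativeRing.commutativeRing (HeytingField.heytingCommutativeRing F)

  open CommutativeRing commutativeRing hiding (zero)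
  open HeytingField F using (_#_; tight; #⇒invertible; #-irrefl)
  open import Algebra.Apartness.Properties.HeytingCommutativeRing
    (HeytingField.heytingCommutativeRing F) using (1#0)
  open import Algebra.Properties.Ring ring
  open import Algebra.Properties.Semiring.Exp semiring using (^-congˡ) renaming (_^_ to _^ᴿ_)
  open import Algebra.Properties.Semiring.Mult semiring using () renaming (_×_ to _×ᴿ_)
  open import Algebra.Properties.CommutativeMonoid.Sum *-commutativeMonoid
    using () renaming (sum to product; sum-remove to product-remove; sum-replicate to product-replicate;
                       sum-cong-≋ to product-cong; ∑-distrib-+ to product-distrib-*)
  open import Algebra.Properties.CommutativeMonoid.Sum +-commutativeMonoid using (∑-distrib-+; sum-replicate)
  open import Relation.Binary.Reasoning.Setoid setoid
  open IntegerSolver commutativeRing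
  open MonicPolynomial commutativeRing
  open Bijection enum using (to; to⁻; injective) renaming (cong to to-cong)
  private
    module Sum = FiniteSum enum +-commutativeMonoid
    module Product = FiniteSum enum *-commutativeMonoid
  open Sum using (to-to⁻; to⁻-to)

  infix 4 _≟_
  _≟_ : Decidable _≈_
  x ≟ y = map′ injective to-cong (to x Fin.≟ to y)

  1≉0 : ¬ 1# ≈ 0#
  1≉0 1≈0 = #-irrefl 1≈0 1#0

  -- Search through the finite carrier. If it fails, x cannot be apart from 0, so x ≈ 0 by
  -- tightness.
  inverse : ∀ {x} → ¬ x ≈ 0# → ∃ λ y → x * y ≈ 1#
  inverse {x} x≉0 with any? (λ i → x * to⁻ i ≟ 1#)
  ... | yes (i , eq) = to⁻ i , eq
  ... | no ¬inv      = contradiction (proj₁ (tight x 0#) ¬x#0) x≉0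
    where
    ¬x#0 : ¬ x # 0#
    ¬x#0 x#0 with y , _ , [x-0]*y≈1 ← #⇒invertible x#0 = ¬inv (to y , (begin
      x * to⁻ (to y)  ≈⟨ *-cong (sym (trans (+-congˡ -0#≈0#) (+-identityʳ x))) (to⁻-to y) ⟩
      (x - 0#) * y    ≈⟨ [x-0]*y≈1 ⟩
      1#              ∎))

  *-cancelˡ : ∀ {x y z} → ¬ x ≈ 0# → x * y ≈ x * z → y ≈ z
  *-cancelˡ {x} {y} {z} x≉0 xy≈xz with w , xw≈1 ← inverse x≉0 = begin
    y            ≈⟨ trans (*-congʳ (trans (*-comm w x) xw≈1)) (*-identityˡ y) ⟨
    w * x * y    ≈⟨ trans (*-assoc w x y) (*-congˡ xy≈xz) ⟩
    w * (x * z)  ≈⟨ *-assoc w x z ⟨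
    w * x * z    ≈⟨ trans (*-congʳ (trans (*-comm w x) xw≈1)) (*-identityˡ z) ⟩
    z            ∎

  integral : ∀ {x y} → x * y ≈ 0# → x ≈ 0# ⊎ y ≈ 0#
  integral {x} xy≈0 with x ≟ 0#
  ... | yes x≈0 = inj₁ x≈0
  ... | no  x≉0 = inj₂ (*-cancelˡ x≉0 (trans xy≈0 (sym (zeroʳ x))))

  *-nonzero : ∀ {x y} → ¬ x ≈ 0# → ¬ y ≈ 0# → ¬ x * y ≈ 0#
  *-nonzero x≉0 y≉0 xy≈0 with integral xy≈0
  ... | inj₁ x≈0 = x≉0 x≈0
  ... | inj₂ y≈0 = y≉0 y≈0

  ^-nonzero : ∀ {x} m → ¬ x ≈ 0# → ¬ x ^ᴿ m ≈ 0#
  ^-nonzero zero    x≉0 = 1≉0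
  ^-nonzero (suc m) x≉0 = *-nonzero x≉0 (^-nonzero m x≉0)

  x²≈1⇒x≈±1 : ∀ {x} → x * x ≈ 1# → x ≈ 1# ⊎ x ≈ - 1#
  x²≈1⇒x≈±1 {x} x²≈1 with integral {x - 1#} {x - - 1#} (begin
    (x - 1#) * (x - - 1#)  ≈⟨ solve 1 (λ x → (x :- con (+ 1)) :* (x :- :- con (+ 1)) := x :* x :- con (+ 1)) refl x ⟩
    x * x - 1#             ≈⟨ x≈y⇒x∙y⁻¹≈ε x²≈1 ⟩
    0#                     ∎)
  ... | inj₁ eq = inj₁ (x∙y⁻¹≈ε⇒x≈y x 1# eq)
  ... | inj₂ eq = inj₂ (x∙y⁻¹≈ε⇒x≈y x (- 1#) eq)

  -- Translation by 1 permutes the field, so adding n times 1 does not change the sum of all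
  -- elements.
  order×1≈0 : n ×ᴿ 1# ≈ 0#
  order×1≈0 = +-identityʳ-unique (Sum.total id) (n ×ᴿ 1#) (sym (begin
    Sum.total id                ≈⟨ Sum.total-reindex id (_+ 1#) (_- 1#) +-congʳ +-congʳ
                                     (λ x → trans (+-assoc x _ _) (trans (+-congˡ (-‿inverseˡ 1#)) (+-identityʳ x)))
                                     (λ x → trans (+-assoc x _ _) (trans (+-congˡ (-‿inverseʳ 1#)) (+-identityʳ x))) ⟩
    Sum.total (_+ 1#)           ≈⟨ ∑-distrib-+ to⁻ (λ _ → 1#) ⟩
    Sum.total id + Sum.total (λ _ → 1#)  ≈⟨ +-congˡ (sum-replicate n) ⟩
    Sum.total id + n ×ᴿ 1#      ∎))

  product-nonzero : ∀ {m} (t : Fin m → Carrier) → (∀ i → ¬ t i ≈ 0#) → ¬ product t ≈ 0#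
  product-nonzero {zero}  t t≉0 = 1≉0
  product-nonzero {suc m} t t≉0 = *-nonzero (t≉0 zero) (product-nonzero (t ∘ suc) (t≉0 ∘ suc))

  -- The additional a stands in for the factor 1 at index i, so that m equal factors result.
  product-const-except : ∀ {m} (i : Fin m) (t : Fin m → Carrier) a → t i ≈ 1# →
                         (∀ j → j ≢ i → t j ≈ a) → a * product t ≈ a ^ᴿ m
  product-const-except {suc m} i t a ti≈1 tj≈a = *-congˡ (begin
    product t                     ≈⟨ product-remove {i = i} t ⟩
    t i * product (removeAt t i)  ≈⟨ *-cong ti≈1 (product-cong λ j → tj≈a _ (punchInᵢ≢i i j)) ⟩
    1# * product {m} (λ _ → a)    ≈⟨ trans (*-identityˡ _) (product-replicate m) ⟩
    a ^ᴿ m                        ∎)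

  0^n≈0 : ∀ {m} → Fin m → 0# ^ᴿ m ≈ 0#
  0^n≈0 {suc m} _ = zeroˡ _

  -- Multiplication by a permutes the nonzero elements, so that the product of all of
  -- them is unchanged when each factor is multiplied by a.
  fermat : ∀ a → a ^ᴿ n ≈ a
  fermat a with a ≟ 0#
  ... | yes a≈0 = trans (^-congˡ n a≈0) (trans (0^n≈0 (to a)) (sym a≈0))
  ... | no  a≉0 = begin
    a ^ᴿ n                      ≈⟨ product-const-except (to 0#) (scale ∘ to⁻) a
                                    (if-zero (to⁻-to 0#)) scale≈a ⟨
    a * Product.total scale     ≈⟨ *-congˡ scale≈1 ⟩
    a * 1#                      ≈⟨ *-identityʳ a ⟩
    a                           ∎
    where
    choose : Carrier → ∀ {x} → Dec (x ≈ 0#) → Carrier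
    choose y (yes _) = 1#
    choose y (no  _) = y
    -- `unit` replaces 0 by 1, so that the product of the nonzero elements runs over the whole
    -- carrier; `scale` is the factor by which `unit` changes when its argument is multiplied by a.
    unit scale : Carrier → Carrier
    unit  x = choose x (x ≟ 0#)
    scale x = choose a (x ≟ 0#)
    if-zero : ∀ {y x} → x ≈ 0# → choose y (x ≟ 0#) ≈ 1#
    if-zero {x = x} x≈0 with x ≟ 0#
    ... | yes _   = refl
    ... | no  x≉0 = contradiction x≈0 x≉0
    if-nonzero : ∀ {y x} → ¬ x ≈ 0# → choose y (x ≟ 0#) ≈ y
    if-nonzero {x = x} x≉0 with x ≟ 0#
    ... | yes x≈0 = contradiction x≈0 x≉0
    ... | no  _   = refl
    unit-nonzero : ∀ x → ¬ unit x ≈ 0#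
    unit-nonzero x with x ≟ 0#
    ... | yes _   = 1≉0
    ... | no  x≉0 = x≉0
    unit-cong : ∀ {x y} → x ≈ y → unit x ≈ unit y
    unit-cong {x} {y} x≈y with y ≟ 0#
    ... | yes y≈0 = if-zero (trans x≈y y≈0)
    ... | no  y≉0 = trans (if-nonzero (λ x≈0 → y≉0 (trans (sym x≈y) x≈0))) x≈y
    unit-* : ∀ x → unit (a * x) ≈ scale x * unit x
    unit-* x with x ≟ 0#
    ... | yes x≈0 = trans (if-zero (trans (*-congˡ x≈0) (zeroʳ a))) (sym (*-identityˡ 1#))
    ... | no  x≉0 = if-nonzero (*-nonzero a≉0 x≉0)
    scale≈a : ∀ j → j ≢ to 0# → scale (to⁻ j) ≈ a
    scale≈a j j≢to0 = if-nonzero λ eq → j≢to0 (≡.trans (≡.sym (to-to⁻ j)) (to-cong eq))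
    a⁻¹ = proj₁ (inverse a≉0)
    a*a⁻¹ = proj₂ (inverse a≉0)
    scale≈1 : Product.total scale ≈ 1#
    scale≈1 = *-cancelˡ (product-nonzero (unit ∘ to⁻) (unit-nonzero ∘ to⁻)) (begin
      Product.total unit * Product.total scale  ≈⟨ *-comm _ _ ⟩
      Product.total scale * Product.total unit  ≈⟨ product-distrib-* (scale ∘ to⁻) (unit ∘ to⁻) ⟨
      Product.total (λ x → scale x * unit x)    ≈⟨ product-cong (λ i → unit-* (to⁻ i)) ⟨
      Product.total (unit ∘ (a *_))             ≈⟨ Product.total-reindex unit-cong (a *_) (a⁻¹ *_) *-congˡ *-congˡ
        (λ x → trans (sym (*-assoc _ _ _)) (trans (*-congʳ a*a⁻¹) (*-identityˡ x)))
        (λ x → trans (sym (*-assoc _ _ _)) (trans (*-congʳ (trans (*-comm _ _) a*a⁻¹)) (*-identityˡ x))) ⟨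
      Product.total unit                        ≈⟨ *-identityʳ _ ⟨
      Product.total unit * 1#                   ∎)

  -- X^(m+2) - X has at most m + 2 roots.
  non-root : ∀ m → suc (suc m) < n → ∃ λ y → ¬ y ^ᴿ suc (suc m) ≈ y
  non-root m 2+m<n with any? (λ i → ¬? (to⁻ i ^ᴿ suc (suc m) ≟ to⁻ i))
  ... | yes (i , neq) = to⁻ i , neq
  ... | no  all-roots = contradiction roots (root-bound 1≉0 integral cs r r-injective)
    where
    -- The coefficients of X^(m+2) - X below the leading one; the degree m + 2 is tested against m +
    -- 3 distinct elements.
    cs = 0# ∷ - 1# ∷ replicate m 0#
    r : Fin (suc (suc (suc m))) → Carrier
    r i = to⁻ (inject≤ i 2+m<n)
    r-injective : ∀ {i j} → r i ≈ r j → i ≡ j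
    r-injective eq = inject≤-injective 2+m<n 2+m<n _ _
      (≡.trans (≡.sym (to-to⁻ _)) (≡.trans (to-cong eq) (to-to⁻ _)))
    roots : ∀ i → eval cs (r i) ≈ 0#
    roots i = begin
      eval cs x                             ≈⟨ +-congˡ (*-congˡ (+-congˡ (*-congˡ (eval-replicate-0# m x)))) ⟩
      0# + x * (- 1# + x * x ^ᴿ m)          ≈⟨ solve 2 (λ x y → con (+ 0) :+ x :* (:- con (+ 1) :+ x :* y)
                                                 := x :* (x :* y) :- x) refl x (x ^ᴿ m) ⟩
      x ^ᴿ suc (suc m) - x                  ≈⟨ x≈y⇒x∙y⁻¹≈ε (decidable-stable (_ ≟ _) λ neq → all-roots (_ , neq)) ⟩
      0#                                    ∎
      where x = r i

-- Odd numbers and their squares.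

abstract
  odd-square : ∀ k → suc (k ℕ.* 2) ^ 2 ≡ suc ((k ℕ.* suc k) ℕ.* 2 ℕ.* 2)
  odd-square = solve 1 (λ k → (con 1 :+ k :* con 2) :^ 2 := con 1 :+ k :* (con 1 :+ k) :* con 2 :* con 2) ≡.refl
    where open import Data.Nat.Solver; open +-*-Solver

odd⇒≡1+2k : ∀ {q} → ¬ (2 ∣ q) → ∃ λ k → q ≡ suc (k ℕ.* 2)
odd⇒≡1+2k {q} 2∤q with q divMod 2
... | result k zero       q≡ = contradiction (divides k q≡) 2∤q
... | result k (suc zero) q≡ = k , q≡

-- The field of order q²: conjugation, real elements, a nonsquare.

module QuadraticExtension {c ℓ₁ ℓ₂} {q} k (primePower : IsPrimePower q) (q≡1+2k : q ≡ suc (k ℕ.* 2))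
                          (F : HeytingField c ℓ₁ ℓ₂) (enum : IsFieldOfOrder F (q ^ 2)) where

  open import Data.Product.Base using (_×_)

  open FiniteField F enum
  open CommutativeRing commutativeRing hiding (zero)
  open import Algebra.Properties.CommutativeSemiring.Exp commutativeSemiring
    using (^-congʳ; ^-congˡ; ^-assocʳ; ^-distrib-*) renaming (_^_ to _^ᴿ_)
  open import Algebra.Properties.Ring ring
  open import Algebra.Properties.Semiring.Mult semiring
    using (×-congˡ; ×1-homo-*) renaming (_×_ to _×ᴿ_)
  open import Relation.Binary.Reasoning.Setoid setoid
  open IntegerSolver commutativeRing

  -- This is (q² - 1) / 2. The factors k, k + 1 and 2 are kept visible because `imaginary` and the
  -- real square root of -1 regroup them.
  half-order : ℕ
  half-order = (k ℕ.* suc k) ℕ.* 2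

  q²≡1+2h : q ^ 2 ≡ suc (half-order ℕ.* 2)
  q²≡1+2h = ≡.trans (≡.cong (_^ 2) q≡1+2k) (odd-square k)

  -- The order q² annihilates 1, and F has no zero divisors.
  q×1≈0 : q ×ᴿ 1# ≈ 0#
  q×1≈0 with integral (trans (sym (×1-homo-* q (q ℕ.* 1))) order×1≈0)
  ... | inj₁ q×1≈0 = q×1≈0
  ... | inj₂ eq    = trans (×-congˡ (≡.sym (ℕ.*-identityʳ q))) eq

  2k×1≈-1 : (k ℕ.* 2) ×ᴿ 1# ≈ - 1#
  2k×1≈-1 = +-inverseʳ-unique 1# _ (trans (×-congˡ (≡.sym q≡1+2k)) q×1≈0)

  two : Carrier
  two = 1# + 1#

  -- As q = 1 + 2k vanishes in F, -1 is k times 2; hence 2 = 0 would give 1 = 0.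
  two≉0 : ¬ two ≈ 0#
  two≉0 2≈0 = 1≉0 (begin
    1#                              ≈⟨ -‿involutive 1# ⟨
    - - 1#                          ≈⟨ -‿cong 2k×1≈-1 ⟨
    - ((k ℕ.* 2) ×ᴿ 1#)             ≈⟨ -‿cong (×1-homo-* k 2) ⟩
    - ((k ×ᴿ 1#) * (1# + (1# + 0#)))  ≈⟨ -‿cong (*-congˡ (trans (+-congˡ (+-identityʳ 1#)) 2≈0)) ⟩
    - ((k ×ᴿ 1#) * 0#)              ≈⟨ trans (-‿cong (zeroʳ _)) -0#≈0# ⟩
    0#                              ∎)

  conj : Carrier → Carrier
  conj x = x ^ᴿ q

  conj-cong : ∀ {x y} → x ≈ y → conj x ≈ conj y
  conj-cong = ^-congˡ q

  conj-* : ∀ x y → conj (x * y) ≈ conj x * conj y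
  conj-* x y = ^-distrib-* x y q

  -- Since q is a power of p and vanishes in F, so does p, and the additivity of p-power maps
  -- applies.
  conj-+ : ∀ x y → conj (x + y) ≈ conj x + conj y
  conj-+ x y = from primePower
    where
    base≈0 : ∀ p e → (p ^ e) ×ᴿ 1# ≈ 0# → p ×ᴿ 1# ≈ 0#
    base≈0 p zero    eq = contradiction (trans (sym (+-identityʳ 1#)) eq) 1≉0
    base≈0 p (suc e) eq with integral (trans (sym (×1-homo-* p (p ^ e))) eq)
    ... | inj₁ p×1≈0 = p×1≈0
    ... | inj₂ eq′   = base≈0 p e eq′
    from : IsPrimePower q → conj (x + y) ≈ conj x + conj y
    from (p , e , pr , _ , q≡p^e) = begin
      conj (x + y)                     ≈⟨ ^-congʳ (x + y) q≡p^e ⟩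
      (x + y) ^ᴿ (p ^ e)               ≈⟨ Frobenius.^p^k-homo-+ commutativeSemiring pr
                                            (base≈0 p e (trans (×-congˡ (≡.sym q≡p^e)) q×1≈0)) e x y ⟩
      x ^ᴿ (p ^ e) + y ^ᴿ (p ^ e)      ≈⟨ +-cong (^-congʳ x q≡p^e) (^-congʳ y q≡p^e) ⟨
      conj x + conj y                  ∎

  1^n≈1 : ∀ n → 1# ^ᴿ n ≈ 1#
  1^n≈1 zero    = refl
  1^n≈1 (suc n) = trans (*-identityˡ _) (1^n≈1 n)

  conj-1 : conj 1# ≈ 1#
  conj-1 = 1^n≈1 q

  conj-0 : conj 0# ≈ 0#
  conj-0 = x+x≈x⇒x≈0 _ (trans (sym (conj-+ 0# 0#)) (conj-cong (+-identityʳ 0#)))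

  conj-neg : ∀ x → conj (- x) ≈ - conj x
  conj-neg x = +-inverseʳ-unique (conj x) (conj (- x))
    (trans (sym (conj-+ x (- x))) (trans (conj-cong (-‿inverseʳ x)) conj-0))

  conj-involutive : ∀ x → conj (conj x) ≈ x
  conj-involutive x = trans (^-assocʳ x q q)
    (trans (^-congʳ x (≡.cong (q ℕ.*_) (≡.sym (ℕ.*-identityʳ q)))) (fermat x))

  -- The elements of the subfield of order q.
  Real : Carrier → Set ℓ₁
  Real x = conj x ≈ x

  real-1 : Real 1#
  real-1 = conj-1

  real-0 : Real 0#
  real-0 = conj-0

  real-+ : ∀ {x y} → Real x → Real y → Real (x + y)
  real-+ rx ry = trans (conj-+ _ _) (+-cong rx ry)

  real-* : ∀ {x y} → Real x → Real y → Real (x * y)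
  real-* rx ry = trans (conj-* _ _) (*-cong rx ry)

  real-neg : ∀ {x} → Real x → Real (- x)
  real-neg rx = trans (conj-neg _) (-‿cong rx)

  real-inverse : ∀ {x y} → ¬ x ≈ 0# → x * y ≈ 1# → Real x → Real y
  real-inverse {x} {y} x≉0 xy≈1 rx = *-cancelˡ x≉0 (begin
    x * conj y       ≈⟨ *-congʳ rx ⟨
    conj x * conj y  ≈⟨ conj-* x y ⟨
    conj (x * y)     ≈⟨ trans (conj-cong xy≈1) conj-1 ⟩
    1#               ≈⟨ xy≈1 ⟨
    x * y            ∎)

  x^[n*2]≈x^n*x^n : ∀ x n → x ^ᴿ (n ℕ.* 2) ≈ x ^ᴿ n * x ^ᴿ n
  x^[n*2]≈x^n*x^n x n = trans (sym (^-assocʳ x n 2)) (*-congˡ (*-identityʳ _))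

  [-1]^2n≈1 : ∀ n → (- 1#) ^ᴿ (n ℕ.* 2) ≈ 1#
  [-1]^2n≈1 n = trans (x^[n*2]≈x^n*x^n (- 1#) n) (trans (sym (^-distrib-* (- 1#) (- 1#) n))
    (trans (^-congˡ n (solve 0 (:- con (+ 1) :* :- con (+ 1) := con (+ 1)) refl)) (1^n≈1 n)))

  -- Let h be `half-order`. A non-root y of X^(h+1) - X is nonzero with y^h different from 1, while
  -- (y^h)² = y^(q²-1) = 1 leaves only y^h = -1.
  nonsquare : ∃ λ y → ¬ y ≈ 0# × y ^ᴿ half-order ≈ - 1#
  nonsquare = y , y≉0 , [ (λ eq → contradiction (trans (*-congˡ eq) (*-identityʳ y)) y^[1+h]≉y) , (λ eq → eq) ]′
    (x²≈1⇒x≈±1 (trans (sym (x^[n*2]≈x^n*x^n y half-order)) y^2h≈1))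
    where
    witness : ∃ λ y → ¬ y ^ᴿ suc half-order ≈ y
    witness with half-order | q²≡1+2h
    -- `non-root` takes an exponent of at least 2, so h = 0 is excluded first: it would make the
    -- field trivial.
    ... | zero  | q²≡1 = contradiction (trans (sym (+-identityʳ 1#))
                           (trans (×-congˡ (≡.sym q²≡1)) order×1≈0)) 1≉0
    ... | suc m | q²≡  = non-root m (≡.subst (suc (suc m) <_) (≡.sym q²≡)
                           (s≤s (s≤s (s≤s (ℕ.m≤m*n m 2)))))
    y = proj₁ witness
    y^[1+h]≉y = proj₂ witness
    y≉0 : ¬ y ≈ 0#
    y≉0 y≈0 = y^[1+h]≉y (trans (*-congʳ y≈0) (trans (zeroˡ _) (sym y≈0)))
    y^2h≈1 : y ^ᴿ (half-order ℕ.* 2) ≈ 1#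
    y^2h≈1 = *-cancelˡ y≉0 (trans (^-congʳ y (≡.sym q²≡1+2h)) (trans (fermat y) (sym (*-identityʳ y))))

  conj-root : ∀ {z} → z ^ᴿ (k ℕ.* 2) ≈ - 1# → conj z ≈ - z
  conj-root {z} eq = begin
    conj z                   ≈⟨ ^-congʳ z q≡1+2k ⟩
    z * z ^ᴿ (k ℕ.* 2)       ≈⟨ *-congˡ eq ⟩
    z * - 1#                 ≈⟨ trans (*-comm z _) (-1*x≈-x z) ⟩
    - z                      ∎

  -- The exponent of δ = y^(k+1) satisfies (k + 1)(q - 1) = `half-order`, so δ^(q-1) = -1.
  imaginary : ∃ λ δ → ¬ δ ≈ 0# × conj δ ≈ - δ
  imaginary = δ , δ≉0 , conj-root δ^2k≈-1
    where
    y = proj₁ nonsquare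
    δ = y ^ᴿ suc k
    δ^2k≈-1 : δ ^ᴿ (k ℕ.* 2) ≈ - 1#
    δ^2k≈-1 = trans (^-assocʳ y (suc k) (k ℕ.* 2)) (trans (^-congʳ y
      (≡.trans (≡.sym (ℕ.*-assoc (suc k) k 2)) (≡.cong (ℕ._* 2) (ℕ.*-comm (suc k) k)))) (proj₂ (proj₂ nonsquare)))
    δ≉0 : ¬ δ ≈ 0#
    δ≉0 = ^-nonzero (suc k) (proj₁ (proj₂ nonsquare))

  real-imaginary² : ∀ {x} → conj x ≈ - x → Real (x * x)
  real-imaginary² {x} x̄≈-x = trans (conj-* x x) (trans (*-cong x̄≈-x x̄≈-x)
    (solve 1 (λ x → :- x :* :- x := x :* x) refl x))

  -- Sums of two real squares.

  SumOfTwoRealSquares : Carrier → Set _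
  SumOfTwoRealSquares x = ∃₂ λ α β → Real α × Real β × α * α + β * β ≈ x

  module q≡1mod4 (l : ℕ) (k≡2l : k ≡ l ℕ.* 2) where

    -- A square root of -1: the exponent is half of `half-order`.
    i : Carrier
    i = proj₁ nonsquare ^ᴿ (k ℕ.* suc k)

    i²≈-1 : i * i ≈ - 1#
    i²≈-1 = trans (sym (x^[n*2]≈x^n*x^n _ (k ℕ.* suc k))) (proj₂ (proj₂ nonsquare))

    -- Here i^(q-1) = (i²)^k = (-1)^k, and k is even.
    real-i : Real i
    real-i = begin
      conj i                   ≈⟨ ^-congʳ i q≡1+2k ⟩
      i * i ^ᴿ (k ℕ.* 2)       ≈⟨ *-congˡ (trans (x^[n*2]≈x^n*x^n i k)
                                 (trans (sym (^-distrib-* i i k)) (^-congˡ k i²≈-1))) ⟩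
      i * (- 1#) ^ᴿ k          ≈⟨ *-congˡ (trans (^-congʳ (- 1#) k≡2l) ([-1]^2n≈1 l)) ⟩
      i * 1#                   ≈⟨ *-identityʳ i ⟩
      i                        ∎

    -- g = ((g + 1) / 2)² - ((1 - g) / 2)², and -1 = i² turns the difference into a sum.
    sumOfTwoSquares : ∀ {g} → Real g → SumOfTwoRealSquares g
    sumOfTwoSquares {g} rg with h , 2h≈1 ← inverse two≉0 =
      h * (g + 1#) , h * (i * (1# - g)) ,
      real-* rh (real-+ rg real-1) ,
      real-* rh (real-* real-i (real-+ real-1 (real-neg rg))) , (begin
        h * (g + 1#) * (h * (g + 1#)) + h * (i * (1# - g)) * (h * (i * (1# - g)))
          ≈⟨ solve 3 (λ g h i → h :* (g :+ con (+ 1)) :* (h :* (g :+ con (+ 1)))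
                :+ h :* (i :* (con (+ 1) :- g)) :* (h :* (i :* (con (+ 1) :- g)))
             := h :* h :* ((g :+ con (+ 1)) :* (g :+ con (+ 1)) :+ i :* i :* ((con (+ 1) :- g) :* (con (+ 1) :- g))))
             refl g h i ⟩
        h * h * ((g + 1#) * (g + 1#) + i * i * ((1# - g) * (1# - g)))
          ≈⟨ *-congˡ (+-congˡ (*-congʳ i²≈-1)) ⟩
        h * h * ((g + 1#) * (g + 1#) + - 1# * ((1# - g) * (1# - g)))
          ≈⟨ solve 2 (λ g h → h :* h :* ((g :+ con (+ 1)) :* (g :+ con (+ 1)) 
                :+ :- con (+ 1) :* ((con (+ 1) :- g) :* (con (+ 1) :- g)))
             := (con (+ 1) :+ con (+ 1)) :* h :* ((con (+ 1) :+ con (+ 1)) :* h) :* g) refl g h ⟩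
        two * h * (two * h) * g
          ≈⟨ *-congʳ (*-cong 2h≈1 2h≈1) ⟩
        1# * 1# * g
          ≈⟨ trans (*-congʳ (*-identityˡ 1#)) (*-identityˡ g) ⟩
        g ∎)
      where
      rh : Real h
      rh = real-inverse two≉0 2h≈1 (real-+ real-1 real-1)

  module q≡3mod4 (l : ℕ) (k≡1+2l : k ≡ suc (l ℕ.* 2)) where

    -- For x ≠ 0 take w = x^(l+1). Then w² = x^(2l+2) = x x^k, and x^k is 1 or -1 because its square
    -- is x^(q-1) = 1.
    ±square : ∀ {x} → Real x → ∃ λ w → Real w × (w * w ≈ x ⊎ w * w ≈ - x)
    ±square {x} rx with x ≟ 0#
    ... | yes x≈0 = 0# , real-0 , inj₁ (trans (zeroˡ 0#) (sym x≈0))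
    ... | no  x≉0 = w , trans (sym (^-assocʳ-comm (suc l) q)) (^-congˡ (suc l) rx) ,
      [ (λ eq → inj₁ (trans w²≈x*x^k (trans (*-congˡ eq) (*-identityʳ x)))) ,
        (λ eq → inj₂ (trans w²≈x*x^k (trans (*-congˡ eq) (trans (*-comm x _) (-1*x≈-x x))))) ]′
      (x²≈1⇒x≈±1 (trans (sym (x^[n*2]≈x^n*x^n x k)) x^2k≈1))
      where
      w = x ^ᴿ suc l
      ^-assocʳ-comm : ∀ m n → (x ^ᴿ n) ^ᴿ m ≈ (x ^ᴿ m) ^ᴿ n
      ^-assocʳ-comm m n = trans (^-assocʳ x n m) (trans (^-congʳ x (ℕ.*-comm n m)) (sym (^-assocʳ x m n)))
      x^2k≈1 : x ^ᴿ (k ℕ.* 2) ≈ 1#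
      x^2k≈1 = *-cancelˡ x≉0 (trans (^-congʳ x (≡.sym q≡1+2k)) (trans rx (sym (*-identityʳ x))))
      w²≈x*x^k : w * w ≈ x * x ^ᴿ k
      w²≈x*x^k = trans (sym (x^[n*2]≈x^n*x^n x (suc l))) (^-congʳ x (≡.cong suc (≡.sym k≡1+2l)))

    -- Either all of 0, 1, 2, … are squares, including -1, or some a² + 1 is not a square and hence is -w².
    square-or--1 : ∀ n → (∃ λ a → Real a × a * a ≈ n ×ᴿ 1#) ⊎ SumOfTwoRealSquares (- 1#)
    square-or--1 zero    = inj₁ (0# , real-0 , zeroˡ 0#)
    square-or--1 (suc n) with square-or--1 n
    ... | inj₂ rep = inj₂ rep
    ... | inj₁ (a , ra , a²≈n) with ±square (real-+ (real-* ra ra) real-1)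
    ... | w , rw , inj₁ w²≈a²+1 = inj₁ (w , rw , trans w²≈a²+1 (trans (+-comm _ 1#) (+-congˡ a²≈n)))
    -- Now a² + 1 = -w². If w = 0, then a² = -1; otherwise division by w² gives (a / w)² + (1 / w)²
    -- = -1.
    ... | w , rw , inj₂ w²≈-[a²+1] with w ≟ 0#
    ... | yes w≈0 = inj₂ (a , 0# , ra , real-0 , (begin
      a * a + 0# * 0#    ≈⟨ solve 1 (λ a → a :* a :+ con (+ 0) :* con (+ 0)
                              := :- (:- (a :* a :+ con (+ 1))) :- con (+ 1)) refl a ⟩
      - - (a * a + 1#) - 1#  ≈⟨ +-congʳ (-‿cong w²≈-[a²+1]) ⟨
      - (w * w) - 1#       ≈⟨ +-congʳ (-‿cong (trans (*-congʳ w≈0) (zeroˡ w))) ⟩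
      - 0# - 1#            ≈⟨ solve 0 (:- con (+ 0) :- con (+ 1) := :- con (+ 1)) refl ⟩
      - 1#                 ∎))
    ... | no  w≉0 with v , wv≈1 ← inverse w≉0 = inj₂ (a * v , v , real-* ra rv , rv , (begin
      a * v * (a * v) + v * v      ≈⟨ solve 2 (λ a v → a :* v :* (a :* v) :+ v :* v
                                        := :- (:- (a :* a :+ con (+ 1)) :* (v :* v))) refl a v ⟩
      - (- (a * a + 1#) * (v * v)) ≈⟨ -‿cong (*-congʳ w²≈-[a²+1]) ⟨
      - (w * w * (v * v))          ≈⟨ solve 2 (λ w v → :- (w :* w :* (v :* v)) := :- (w :* v :* (w :* v))) refl w v ⟩
      - (w * v * (w * v))          ≈⟨ -‿cong (trans (*-cong wv≈1 wv≈1) (*-identityˡ 1#)) ⟩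
      - 1#                         ∎))
      where
      rv : Real v
      rv = real-inverse w≉0 wv≈1 rw

    sumOfTwoSquares--1 : SumOfTwoRealSquares (- 1#)
    -- The multiple 2k = q - 1 of 1 is -1 in F.
    sumOfTwoSquares--1 with square-or--1 (k ℕ.* 2)
    ... | inj₂ rep            = rep
    ... | inj₁ (a , ra , a²≈) = a , 0# , ra , real-0 ,
      trans (+-congˡ (zeroˡ 0#)) (trans (+-identityʳ _) (trans a²≈ 2k×1≈-1))

    -- Either g = w², or g = -w² and a representation of -1 is scaled by w.
    sumOfTwoSquares : ∀ {g} → Real g → SumOfTwoRealSquares g
    sumOfTwoSquares {g} rg with ±square rg
    ... | w , rw , inj₁ w²≈g  = w , 0# , rw , real-0 ,
      trans (+-congˡ (zeroˡ 0#)) (trans (+-identityʳ _) w²≈g)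
    ... | w , rw , inj₂ w²≈-g with α , β , rα , rβ , α²+β²≈-1 ← sumOfTwoSquares--1 =
      w * α , w * β , real-* rw rα , real-* rw rβ , (begin
        w * α * (w * α) + w * β * (w * β)
          ≈⟨ solve 3 (λ w α β → w :* α :* (w :* α) :+ w :* β :* (w :* β) := w :* w :* (α :* α :+ β :* β)) refl w α β ⟩
        w * w * (α * α + β * β)  ≈⟨ *-cong w²≈-g α²+β²≈-1 ⟩
        - g * - 1#               ≈⟨ solve 1 (λ g → :- g :* :- con (+ 1) := g) refl g ⟩
        g                        ∎)

  sumOfTwoSquares : ∀ {g} → Real g → SumOfTwoRealSquares g
  sumOfTwoSquares with k divMod 2
  ... | result l zero       k≡ = q≡1mod4.sumOfTwoSquares l k≡
  ... | result l (suc zero) k≡ = q≡3mod4.sumOfTwoSquares l k≡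

-- Pairs of points with equal values.

module Collisions {c ℓ₁ ℓ₂} {q} k (primePower : IsPrimePower q) (q≡1+2k : q ≡ suc (k ℕ.* 2))
                  (F : HeytingField c ℓ₁ ℓ₂) (enum : IsFieldOfOrder F (q ^ 2)) where

  open import Data.Product.Base using (_×_)
  open FiniteField F enum
  open QuadraticExtension k primePower q≡1+2k F enum
  open CommutativeRing commutativeRing hiding (zero)
  open import Algebra.Properties.CommutativeSemiring.Exp commutativeSemiring using (^-congʳ; ^-homo-*)
  open import Algebra.Properties.Ring ring
  open import Relation.Binary.Reasoning.Setoid setoid
  open IntegerSolver commutativeRing

  ≈-from-factor : ∀ {x y u v} → x - y ≈ u * v → v ≈ 0# → x ≈ y
  ≈-from-factor {x} {y} {u} eq v≈0 = x∙y⁻¹≈ε⇒x≈y x y (trans eq (trans (*-congˡ v≈0) (zeroʳ u)))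

  -- The conjugate is an independent variable here, so that comparing values of f becomes a
  -- polynomial identity.
  φ : Carrier → Carrier → Carrier → Carrier
  φ γ x x̄ = x + γ * (x * x̄ * ((x - x̄) * (x - x̄)))

  -- `:φ` and `:factor` are the solver expressions for `φ` and `factor`.
  :φ : ∀ {n} → Polynomial n → Polynomial n → Polynomial n → Polynomial n
  :φ γ x x̄ = x :+ γ :* (x :* x̄ :* ((x :- x̄) :* (x :- x̄)))

  φ-cong : ∀ {γ x x̄ ȳ} → x̄ ≈ ȳ → φ γ x x̄ ≈ φ γ x ȳ
  φ-cong x̄≈ȳ = +-congˡ (*-congˡ (*-cong (*-congˡ x̄≈ȳ) (*-cong (+-congˡ (-‿cong x̄≈ȳ)) (+-congˡ (-‿cong x̄≈ȳ)))))

  :factor : ∀ {n} → Polynomial n → Polynomial n → Polynomial n → Polynomial n → Polynomial n → Polynomial n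
  :factor γ γ̄ a b c = con (+ 1) :+ (γ :- γ̄) :* (γ :- γ̄) :*
    (c :* c :* (a :+ b) :+ c :* (γ :+ γ̄) :* (a :* a :+ a :* b :+ b :* b) :+ γ :* γ̄ :* ((a :+ b) :* (a :* a :+ b :* b)))

  -- The argument of the trace is x̄ x³ - x̄² x²; adding its conjugate x x̄³ - x² x̄² leaves x x̄
  -- (x² - 2 x x̄ + x̄²).
  polyF≈φ : ∀ γ x → polyF F q γ x ≈ φ γ x (conj x)
  polyF≈φ γ x = +-congˡ (*-congˡ (begin
    z + conj z
      ≈⟨ +-cong z≈ (trans (conj-cong z≈) conj-z) ⟩
    x̄ * x³ - x̄ * x̄ * x² + (x * (x̄ * (x̄ * (x̄ * 1#))) - x * x * (x̄ * (x̄ * 1#)))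
      ≈⟨ solve 2 (λ x x̄ → let o = con (+ 1) in
           x̄ :* (x :* (x :* (x :* o))) :- x̄ :* x̄ :* (x :* (x :* o))
           :+ (x :* (x̄ :* (x̄ :* (x̄ :* o))) :- x :* x :* (x̄ :* (x̄ :* o)))
           := x :* x̄ :* ((x :- x̄) :* (x :- x̄))) refl x x̄ ⟩
    x * x̄ * ((x - x̄) * (x - x̄)) ∎))
    where
    open import Algebra.Properties.Semiring.Exp semiring using () renaming (_^_ to _^ᴿ_)
    x̄ = conj x
    z = x ^ᴿ (q ℕ.+ 3) - x ^ᴿ (2 ℕ.* q ℕ.+ 2)
    x² = x * (x * 1#)
    x³ = x * (x * (x * 1#))
    x^2q≈ : x ^ᴿ (2 ℕ.* q) ≈ x̄ * x̄
    x^2q≈ = trans (^-homo-* x q (q ℕ.+ 0)) (*-congˡ (^-congʳ x (ℕ.+-identityʳ q)))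
    z≈ : z ≈ x̄ * x³ - x̄ * x̄ * x²
    z≈ = +-cong (^-homo-* x q 3) (-‿cong (trans (^-homo-* x (2 ℕ.* q) 2) (*-congʳ x^2q≈)))
    conj-z : conj (x̄ * x³ - x̄ * x̄ * x²) ≈ x * (x̄ * (x̄ * (x̄ * 1#))) - x * x * (x̄ * (x̄ * 1#))
    conj-z = trans (conj-+ _ _) (+-cong
      (trans (conj-* _ _) (*-cong (conj-involutive x) x̄³))
      (trans (conj-neg _) (-‿cong (trans (conj-* _ _)
        (*-cong (trans (conj-* _ _) (*-cong (conj-involutive x) (conj-involutive x))) x̄²)))))
      where
      x̄² : conj x² ≈ x̄ * (x̄ * 1#)
      x̄² = trans (conj-* _ _) (*-congˡ (trans (conj-* _ _) (*-congˡ conj-1)))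
      x̄³ : conj x³ ≈ x̄ * (x̄ * (x̄ * 1#))
      x̄³ = trans (conj-* _ _) (*-congˡ x̄²)

  -- Change the sign of β if α + β = 0: the sum and the difference cannot both vanish, as their
  -- squares add up to 2 g.
  squares-with-nonzero-sum : ∀ {g} → ¬ g ≈ 0# → Real g →
    ∃₂ λ α β → Real α × Real β × α * α + β * β ≈ g × ¬ α + β ≈ 0#
  squares-with-nonzero-sum {g} g≉0 rg with α , β , rα , rβ , eq ← sumOfTwoSquares rg with α + β ≟ 0#
  ... | no  α+β≉0 = α , β , rα , rβ , eq , α+β≉0
  ... | yes α+β≈0 = α , - β , rα , real-neg rβ , trans (+-congˡ (solve 1 (λ β → :- β :* :- β := β :* β) refl β)) eq ,
    λ α-β≈0 → *-nonzero two≉0 g≉0 (begin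
      two * g
        ≈⟨ *-congˡ eq ⟨
      two * (α * α + β * β)
        ≈⟨ solve 2 (λ α β → (con (+ 1) :+ con (+ 1)) :* (α :* α :+ β :* β)
             := (α :+ β) :* (α :+ β) :+ (α :- β) :* (α :- β)) refl α β ⟩
      (α + β) * (α + β) + (α - β) * (α - β)
        ≈⟨ +-cong (trans (*-congʳ α+β≈0) (zeroˡ _)) (trans (*-congʳ α-β≈0) (zeroˡ _)) ⟩
      0# + 0#
        ≈⟨ +-identityʳ 0# ⟩
      0# ∎)

  -- Change both signs if the last condition fails: the two expressions add up to 4 g, so they
  -- cannot both vanish. This condition will separate the two colliding points.
  separated-squares : ∀ {g} → ¬ g ≈ 0# → Real g → ∀ v →
    ∃₂ λ α β → Real α × Real β × α * α + β * β ≈ g × ¬ α + β ≈ 0# × ¬ v * (α - β) + two * g ≈ 0#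
  separated-squares {g} g≉0 rg v with α , β , rα , rβ , eq , α+β≉0 ← squares-with-nonzero-sum g≉0 rg
                                 with v * (α - β) + two * g ≟ 0#
  ... | no  neq  = α , β , rα , rβ , eq , α+β≉0 , neq
  ... | yes eq₀  = - α , - β , real-neg rα , real-neg rβ ,
    trans (solve 2 (λ α β → :- α :* :- α :+ :- β :* :- β := α :* α :+ β :* β) refl α β) eq ,
    (λ eq′ → α+β≉0 (begin
      α + β            ≈⟨ solve 2 (λ α β → α :+ β := :- (:- α :- β)) refl α β ⟩
      - (- α - β)      ≈⟨ trans (-‿cong eq′) -0#≈0# ⟩
      0#               ∎)) ,
    λ eq₀′ → *-nonzero two≉0 (*-nonzero two≉0 g≉0) (begin
      two * (two * g)
        ≈⟨ solve 4 (λ g v α β → let two = con (+ 1) :+ con (+ 1) in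
             two :* (two :* g) := v :* (α :- β) :+ two :* g :+ (v :* (:- α :- :- β) :+ two :* g)) refl g v α β ⟩
      v * (α - β) + two * g + (v * (- α - - β) + two * g)
        ≈⟨ +-cong eq₀ eq₀′ ⟩
      0# + 0#
        ≈⟨ +-identityʳ 0# ⟩
      0# ∎)

  module _ (γ : Carrier) where

    -- Up to the factor (a - b) γ, the difference of the values at c + a γ and c + b γ; γ̄ is the conjugate of γ.
    factor : Carrier → Carrier → Carrier → Carrier → Carrier
    factor γ̄ a b c = 1# + (γ - γ̄) * (γ - γ̄) *
      (c * c * (a + b) + c * (γ + γ̄) * (a * a + a * b + b * b) + γ * γ̄ * ((a + b) * (a * a + b * b)))

    φ-difference : ∀ γ̄ a b c → φ γ (c + a * γ) (c + a * γ̄) - φ γ (c + b * γ) (c + b * γ̄)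
                             ≈ (a - b) * γ * factor γ̄ a b c
    φ-difference γ̄ a b c = solve 5 (λ γ γ̄ a b c →
      :φ γ (c :+ a :* γ) (c :+ a :* γ̄) :- :φ γ (c :+ b :* γ) (c :+ b :* γ̄)
      := (a :- b) :* γ :* :factor γ γ̄ a b c) refl γ γ̄ a b c

    four : Carrier
    four = 1# + 1# + 1# + 1#

    -- This is 4 γ^6, the coefficient in the form 1 - `fourCube` v to which the factor reduces when
    -- γ̄ = -γ and a + b = v.
    fourCube : Carrier
    fourCube = four * (γ * γ * (γ * γ * (γ * γ)))

    real-4 : Real four
    real-4 = real-+ (real-+ (real-+ real-1 real-1) real-1) real-1

    fourCube≉0 : ¬ γ ≈ 0# → ¬ fourCube ≈ 0#
    fourCube≉0 γ≉0 = *-nonzero four≉0 (*-nonzero γ²≉0 (*-nonzero γ²≉0 γ²≉0))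
      where
      γ²≉0 = *-nonzero γ≉0 γ≉0
      four≉0 : ¬ four ≈ 0#
      four≉0 eq = *-nonzero two≉0 two≉0 (trans (solve 0 ((con (+ 1) :+ con (+ 1)) :* (con (+ 1) :+ con (+ 1))
        := con (+ 1) :+ con (+ 1) :+ con (+ 1) :+ con (+ 1)) refl) eq)

    -- Here γ̄ = -γ, and the factor is 1 + 4 γ² (a + b) (c² - γ² (a² + b²)).  When g = γ² = α² + β², the vector (α, β, g)
    -- is isotropic for the form c² - g (a² + b²) and orthogonal to (β, -α, 0); hence the form is constant along
    -- (a, b, c) = t (α, β, g) + (β, -α, 0), and the factor is affine in t.
    isotropic-factor : ∀ α β t v → α * α + β * β ≈ γ * γ → t * (α + β) + (β - α) ≈ v → fourCube * v ≈ 1# →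
                       factor (- γ) (t * α + β) (t * β - α) (t * (α * α + β * β)) ≈ 0#
    isotropic-factor α β t v g≈γ² sum≈v dv≈1 = begin
      factor (- γ) a b e
        ≈⟨ solve 4 (λ γ a b c → :factor γ (:- γ) a b c
             := con (+ 1) :+ con (+ 4) :* (γ :* γ) :* ((a :+ b) :* (c :* c :- γ :* γ :* (a :* a :+ b :* b))))
             refl γ a b e ⟩
      1# + four * (γ * γ) * ((a + b) * (e * e - γ * γ * (a * a + b * b)))
        ≈⟨ +-congˡ (*-cong (*-congˡ g≈γ²) (*-congˡ (+-congˡ (-‿cong (*-congʳ g≈γ²))))) ⟨
      1# + four * g * ((a + b) * (e * e - g * (a * a + b * b)))
        ≈⟨ +-congˡ (*-congˡ (*-cong a+b≈v (+-congˡ (-‿cong (*-congˡ a²+b²≈))))) ⟩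
      1# + four * g * (v * (t * g * (t * g) - g * ((t * t + 1#) * g)))
        -- The quadratic form takes the value t² g² - (t² + 1) g² = -g², from which t has
        -- disappeared.
        ≈⟨ solve 3 (λ t g v →
             con (+ 1) :+ con (+ 4) :* g :* (v :* (t :* g :* (t :* g) :- g :* ((t :* t :+ con (+ 1)) :* g)))
             := con (+ 1) :- con (+ 4) :* (g :* (g :* g)) :* v) refl t g v ⟩
      1# - four * (g * (g * g)) * v
        ≈⟨ +-congˡ (-‿cong (*-congʳ (*-congˡ (*-cong g≈γ² (*-cong g≈γ² g≈γ²))))) ⟩
      1# - fourCube * v
        ≈⟨ x≈y⇒x∙y⁻¹≈ε (sym dv≈1) ⟩
      0# ∎
      where
      g = α * α + β * β
      a = t * α + β
      b = t * β - α
      e = t * g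
      a+b≈v : a + b ≈ v
      a+b≈v = trans (solve 3 (λ t α β → t :* α :+ β :+ (t :* β :- α) := t :* (α :+ β) :+ (β :- α)) refl t α β) sum≈v
      a²+b²≈ : a * a + b * b ≈ (t * t + 1#) * g
      a²+b²≈ = solve 3 (λ t α β →
        (t :* α :+ β) :* (t :* α :+ β) :+ (t :* β :- α) :* (t :* β :- α)
        := (t :* t :+ con (+ 1)) :* (α :* α :+ β :* β)) refl t α β

    -- For a = t α + β and b = t β - α, the product (α + β)(a - b) equals v (α - β) + 2 (α² + β²).
    distinct-coordinates : ∀ {α β t v} → t * (α + β) ≈ v + (α - β) →
      ¬ v * (α - β) + two * (α * α + β * β) ≈ 0# → ¬ t * α + β ≈ t * β - α
    distinct-coordinates {α} {β} {t} {v} t[α+β]≈ neq a≈b = neq (begin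
      v * (α - β) + two * (α * α + β * β)
        ≈⟨ solve 3 (λ v α β →
             v :* (α :- β) :+ (con (+ 1) :+ con (+ 1)) :* (α :* α :+ β :* β)
             := (v :+ (α :- β)) :* (α :- β) :+ (α :+ β) :* (α :+ β)) refl v α β ⟩
      (v + (α - β)) * (α - β) + (α + β) * (α + β)
        ≈⟨ +-congʳ (*-congʳ t[α+β]≈) ⟨
      t * (α + β) * (α - β) + (α + β) * (α + β)
        ≈⟨ solve 3 (λ t α β → t :* (α :+ β) :* (α :- β) :+ (α :+ β) :* (α :+ β)
             := (α :+ β) :* (t :* α :+ β :- (t :* β :- α))) refl t α β ⟩
      (α + β) * (t * α + β - (t * β - α))
        ≈⟨ trans (*-congˡ (x≈y⇒x∙y⁻¹≈ε a≈b)) (zeroʳ (α + β)) ⟩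
      0# ∎)

    -- Exclusion of nonzero γ under injectivity.

    module _ (f-injective : Injective _≈_ _≈_ (polyF F q γ)) where

      φ-injective : ∀ {x x̄ y ȳ} → conj x ≈ x̄ → conj y ≈ ȳ → φ γ x x̄ ≈ φ γ y ȳ → x ≈ y
      φ-injective {x} {x̄} {y} {ȳ} cx cy eq = f-injective (begin
        polyF F q γ x    ≈⟨ trans (polyF≈φ γ x) (φ-cong cx) ⟩
        φ γ x x̄          ≈⟨ eq ⟩
        φ γ y ȳ          ≈⟨ trans (polyF≈φ γ y) (φ-cong cy) ⟨
        polyF F q γ y    ∎)

      -- As s is real, δ - s has conjugate -δ - s. The values at δ - s and δ then differ by -s (1 -
      -- 4 γ δ² s), which is 0 for s = 1 / (4 γ δ²).
      ¬real : ¬ γ ≈ 0# → ¬ Real γ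
      ¬real γ≉0 rγ with δ , δ≉0 , δ̄≈-δ ← imaginary = contradiction collision s≉0
        where
        d : Carrier
        d = two * two * (γ * (δ * δ))
        d≉0 : ¬ d ≈ 0#
        d≉0 = *-nonzero (*-nonzero two≉0 two≉0) (*-nonzero γ≉0 (*-nonzero δ≉0 δ≉0))
        s = proj₁ (inverse d≉0)
        ds≈1 : d * s ≈ 1#
        ds≈1 = proj₂ (inverse d≉0)
        rs : Real s
        rs = real-inverse d≉0 ds≈1 (real-* (real-* r2 r2) (real-* rγ (real-imaginary² δ̄≈-δ)))
          where
          r2 = real-+ real-1 real-1
        s≉0 : ¬ s ≈ 0#
        s≉0 s≈0 = 1≉0 (trans (sym ds≈1) (trans (*-congˡ s≈0) (zeroʳ d)))
        1-ds≈0 : 1# - d * s ≈ 0#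
        1-ds≈0 = x≈y⇒x∙y⁻¹≈ε (sym ds≈1)
        collision : s ≈ 0#
        collision = begin
          s        ≈⟨ -‿involutive s ⟨
          - - s    ≈⟨ -‿cong (+-identityʳ-unique δ (- s) (φ-injective
                        (trans (conj-+ δ (- s)) (+-cong δ̄≈-δ (real-neg rs))) δ̄≈-δ
                        (≈-from-factor φδ-s-φδ 1-ds≈0))) ⟩
          - 0#     ≈⟨ -0#≈0# ⟩
          0#       ∎
          where
          φδ-s-φδ : φ γ (δ - s) (- δ - s) - φ γ δ (- δ) ≈ - s * (1# - d * s)
          φδ-s-φδ = solve 3 (λ γ δ s →
            let o = con (+ 1)
            in :φ γ (δ :- s) (:- δ :- s) :- :φ γ δ (:- δ)
               := :- s :* (o :- (o :+ o) :* (o :+ o) :* (γ :* (δ :* δ)) :* s)) refl γ δ s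

      -- By `φ-difference` a zero would give c + a γ and c + b γ the same value; injectivity and
      -- cancellation of c and γ then force a ≈ b.
      factor≉0 : ¬ γ ≈ 0# → ∀ {γ̄ a b c} → conj γ ≈ γ̄ → Real a → Real b → Real c →
                       ¬ a ≈ b → ¬ factor γ̄ a b c ≈ 0#
      factor≉0 γ≉0 {γ̄} {a} {b} {c} cγ ra rb rc a≉b eq = a≉b (*-cancelˡ γ≉0 (begin
        γ * a    ≈⟨ *-comm γ a ⟩
        a * γ    ≈⟨ +-cancelˡ c (a * γ) (b * γ)
                      (φ-injective (conj-point ra) (conj-point rb) (≈-from-factor (φ-difference γ̄ a b c) eq)) ⟩
        b * γ    ≈⟨ *-comm b γ ⟩
        γ * b    ∎))
        where
        conj-point : ∀ {a} → Real a → conj (c + a * γ) ≈ c + a * γ̄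
        conj-point ra = trans (conj-+ _ _) (+-cong rc (trans (conj-* _ _) (*-cong ra cγ)))

      -- The choice a = 1, b = -1 removes the terms with a + b and leaves 1 + m c, linear in c. If
      -- the trace were nonzero, m would be invertible, because γ is not real.
      trace-zero : ¬ γ ≈ 0# → γ + conj γ ≈ 0#
      trace-zero γ≉0 = decidable-stable (_ ≟ _) λ τ≉0 →
        let D≉0 : ¬ (γ - γ̄) * (γ - γ̄) ≈ 0#
            D≉0 = *-nonzero γ-γ̄≉0 γ-γ̄≉0
            m = (γ - γ̄) * (γ - γ̄) * (γ + γ̄)
            m≉0 : ¬ m ≈ 0#
            m≉0 = *-nonzero D≉0 τ≉0
            w , mw≈1 = inverse m≉0
            rw : Real w
            rw = real-inverse m≉0 mw≈1 (real-* rD rτ)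
        in factor≉0 γ≉0 refl real-1 (real-neg real-1) (real-neg rw) 1≉-1 (begin
          factor γ̄ 1# (- 1#) (- w)
            ≈⟨ solve 3 (λ γ γ̄ w → :factor γ γ̄ (con (+ 1)) (:- con (+ 1)) (:- w)
                 := con (+ 1) :- (γ :- γ̄) :* (γ :- γ̄) :* (γ :+ γ̄) :* w) refl γ γ̄ w ⟩
          1# - m * w  ≈⟨ x≈y⇒x∙y⁻¹≈ε (sym mw≈1) ⟩
          0#          ∎)
        where
        γ̄ = conj γ
        γ-γ̄≉0 : ¬ γ - γ̄ ≈ 0#
        γ-γ̄≉0 eq = ¬real γ≉0 (sym (x∙y⁻¹≈ε⇒x≈y γ γ̄ eq))
        rτ : Real (γ + γ̄)
        rτ = trans (conj-+ _ _) (trans (+-congˡ (conj-involutive γ)) (+-comm _ _))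
        rD : Real ((γ - γ̄) * (γ - γ̄))
        rD = trans (conj-* _ _) (trans (*-cong swap swap) (solve 2 (λ γ γ̄ →
               (γ̄ :- γ) :* (γ̄ :- γ) := (γ :- γ̄) :* (γ :- γ̄)) refl γ γ̄))
          where
          swap : conj (γ - γ̄) ≈ γ̄ - γ
          swap = trans (conj-+ _ _) (+-congˡ (trans (conj-neg _) (-‿cong (conj-involutive γ))))
        1≉-1 : ¬ 1# ≈ - 1#
        1≉-1 eq = two≉0 (trans (+-congˡ eq) (-‿inverseʳ 1#))

      ¬trace-zero : ¬ γ ≈ 0# → ¬ γ + conj γ ≈ 0#
      ¬trace-zero γ≉0 τ≈0 =
        let v , dv≈1 = inverse (fourCube≉0 γ≉0)
            γ̄≈-γ = +-inverseʳ-unique γ (conj γ) τ≈0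
            rγ² = real-imaginary² γ̄≈-γ
            α , β , rα , rβ , g≈γ² , α+β≉0 , distinct = separated-squares (*-nonzero γ≉0 γ≉0) rγ² v
            r , [α+β]r≈1 = inverse α+β≉0
            -- The solution of t (α + β) + (β - α) = v, which says a + b = v for a = t α + β and b =
            -- t β - α.
            t = (v + (α - β)) * r
            rv = real-inverse (fourCube≉0 γ≉0) dv≈1 (real-* real-4 (real-* rγ² (real-* rγ² rγ²)))
            rt = real-* (real-+ rv (real-+ rα (real-neg rβ))) (real-inverse α+β≉0 [α+β]r≈1 (real-+ rα rβ))
            t[α+β]≈ = trans (*-assoc _ r (α + β)) (trans (*-congˡ (trans (*-comm r _) [α+β]r≈1)) (*-identityʳ _))
            sum≈v = trans (+-congʳ t[α+β]≈) (solve 3 (λ v α β → v :+ (α :- β) :+ (β :- α) := v) refl v α β)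
        in factor≉0 γ≉0 γ̄≈-γ
             (real-+ (real-* rt rα) rβ) (real-+ (real-* rt rβ) (real-neg rα))
             (real-* rt (real-+ (real-* rα rα) (real-* rβ rβ)))
             (distinct-coordinates t[α+β]≈ λ eq → distinct (trans (+-congˡ (*-congˡ (sym g≈γ²))) eq))
             (isotropic-factor α β t v g≈γ² sum≈v dv≈1)

      f-injective⇒γ≈0 : γ ≈ 0#
      f-injective⇒γ≈0 = decidable-stable (γ ≟ 0#) λ γ≉0 → ¬trace-zero γ≉0 (trace-zero γ≉0)

-- Both directions of the equivalence.

theorem3p8 : ∀ {c ℓ₁ ℓ₂} (q : ℕ) → IsOddPrimePower q →
    (F : HeytingField c ℓ₁ ℓ₂) → IsFieldOfOrder F (q ^ 2) →
    (γ : HeytingField.Carrier F) →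
    IsPermutationPolynomial F (polyF F q γ) ⇔ HeytingField._≈_ F γ (HeytingField.0# F)
theorem3p8 q (primePower , 2∤q) F enum γ =
  let k , q≡1+2k = odd⇒≡1+2k 2∤q in
  mk⇔ (λ (injective , _) → Collisions.f-injective⇒γ≈0 k primePower q≡1+2k F enum γ injective) permutation
  where
  open CommutativeRing (HeytingCommutativeRing.commutativeRing (HeytingField.heytingCommutativeRing F))
  permutation : γ ≈ 0# → IsPermutationPolynomial F (polyF F q γ)
  permutation γ≈0 = (λ {x} {y} eq → trans (sym (f≈id x)) (trans eq (f≈id y))) , λ y → y , λ {z} z≈y → trans (f≈id z) z≈y
    where
    f≈id : ∀ x → polyF F q γ x ≈ x
    f≈id x = trans (+-congˡ (trans (*-congʳ γ≈0) (zeroˡ _))) (+-identityʳ x)
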